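{- Let $m\in\{1,2\}$ and let $n$ be a non-negative integer. Then $A_m(n)=C_m(n)$.
   Context: A partition of $n$ is a finite non-increasing sequence $\pi=(\pi_1,\pi_2,\dots,\pi_k)$ of positive integers with $\pi_1+\dots+\pi_k=n$; the empty sequence is the only partition of $0$. The $\pi_i$ are the parts, and $\pi_i$ is said to have index $i$. $C_m(n)$ denotes the number of partitions of $n$ into distinct parts, none of which is congruent to $m$ or $-m$ modulo $6$. $A_m(n)$ denotes the number of partitions $\pi=(\pi_1,\pi_2,\dots)$ of $n$ such that, for every $r\in\{0,1\}$ and every integer $i\ge 0$ with $2i+r\ge 1$ for which the relevant parts exist: (i) $\pi_{2i+r}\not\equiv 3-m+(-1)^m r \pmod 3$, and (ii) $\pi_{2i+r}-\pi_{2i+1+r}>\lfloor m/2\rfloor+(-1)^{m-1}r$. Equivalently: the odd-indexed parts are not congruent to $m$ modulo $3$, the even-indexed parts are not congruent to $3-m$ modulo $3$, all parts are distinct, and $3l+1$ and $3l+2$ never appear together as consecutive parts for any integer $l$. -}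

module Defs where

open import Data.Nat as ℕ using (ℕ; zero; suc; _≥_; _≤_; _<_; _≟_)
open import Data.Nat.Properties as ℕP using ()
open import Data.Integer as ℤ using (ℤ; +_; -[1+_])
open import Data.Integer.Divisibility as ℤD using ()
open import Data.Nat.ListAction using (sum)
open import Data.Nat.Divisibility using (_∣?_)
open import Data.List using (List; []; _∷_; map; concatMap; applyUpTo; upTo; filter; length)
open import Data.List.Relation.Unary.All using (All; all?)
open import Data.List.Relation.Unary.Linked using (Linked; linked?)
open import Data.List.Relation.Unary.Unique.Propositional using (Unique)
import Data.List.Relation.Unary.Unique.DecPropositional as UDec
open import Data.Product using (_×_; _,_)
open import Data.Unit using (⊤; tt)
open import Relation.Nullary using (¬_; Dec; yes; no; ¬?)
open import Relation.Nullary.Decidable using (_×-dec_)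
open import Relation.Binary.PropositionalEquality using (_≡_)

-- Partitions (lists of ℕ; index 1 = head)

IsPartition : ℕ → List ℕ → Set
IsPartition n π = Linked _≥_ π × All (λ x → 1 ≤ x) π × sum π ≡ n

isPartition? : (n : ℕ) (π : List ℕ) → Dec (IsPartition n π)
isPartition? n π = linked? ℕP._≥?_ π ×-dec (all? (λ x → 1 ℕP.≤? x) π ×-dec (sum π ℕ.≟ n))

words : ℕ → ℕ → List (List ℕ)
words n zero    = [] ∷ []
words n (suc k) = concatMap (λ x → map (x ∷_) (words n k)) (applyUpTo suc n)

-- all lists of length ≤ n with entries in {1,…,n} (each exactly once);
-- every partition of n is among them
candidates : ℕ → List (List ℕ)
candidates n = concatMap (words n) (upTo (suc n))

count : (P : List ℕ → Set) → ((π : List ℕ) → Dec (P π)) → ℕ → ℕ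
count P P? n = length (filter (λ π → isPartition? n π ×-dec P? π) (candidates n))

_≡₃_ : ℤ → ℤ → Set
a ≡₃ b = (+ 3) ℤD.∣ (a ℤ.- b)

_≡₃?_ : (a b : ℤ) → Dec (a ≡₃ b)
a ≡₃? b = 3 ∣? ℤ.∣ a ℤ.- b ∣

_≡₆_ : ℤ → ℤ → Set
a ≡₆ b = (+ 6) ℤD.∣ (a ℤ.- b)

_≡₆?_ : (a b : ℤ) → Dec (a ≡₆ b)
a ≡₆? b = 6 ∣? ℤ.∣ a ℤ.- b ∣

sgn : ℕ → ℤ
sgn zero    = + 1
sgn (suc k) = ℤ.- sgn k

CCond : ℕ → List ℕ → Set
CCond m π = Unique π × All (λ x → ¬ ((+ x) ≡₆ (+ m)) × ¬ ((+ x) ≡₆ (ℤ.- (+ m)))) π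

CCond? : (m : ℕ) (π : List ℕ) → Dec (CCond m π)
CCond? m π = UDec.unique? ℕ._≟_ π
  ×-dec all? (λ x → ¬? ((+ x) ≡₆? (+ m)) ×-dec ¬? ((+ x) ≡₆? (ℤ.- (+ m)))) π

C : ℕ → ℕ → ℕ
C m n = count (CCond m) (CCond? m) n

resA : ℕ → ℕ → ℤ
resA m r = (+ 3) ℤ.- (+ m) ℤ.+ sgn m ℤ.* (+ r)

gapA : ℕ → ℕ → ℤ
gapA m r = (+ (m ℕ./ 2)) ℤ.+ sgn (m ℕ.∸ 1) ℤ.* (+ r)

ACondFrom : ℕ → ℕ → List ℕ → Set
ACondFrom m j []            = ⊤
ACondFrom m j (x ∷ [])      = ¬ ((+ x) ≡₃ resA m (j ℕ.% 2))
ACondFrom m j (x ∷ y ∷ xs)  =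
  ¬ ((+ x) ≡₃ resA m (j ℕ.% 2))
  × gapA m (j ℕ.% 2) ℤ.< (+ x) ℤ.- (+ y)
  × ACondFrom m (suc j) (y ∷ xs)

ACondFrom? : (m j : ℕ) (π : List ℕ) → Dec (ACondFrom m j π)
ACondFrom? m j []           = yes tt
ACondFrom? m j (x ∷ [])     = ¬? ((+ x) ≡₃? resA m (j ℕ.% 2))
ACondFrom? m j (x ∷ y ∷ xs) =
  ¬? ((+ x) ≡₃? resA m (j ℕ.% 2))
  ×-dec (gapA m (j ℕ.% 2) ℤ.<? (+ x) ℤ.- (+ y))
  ×-dec ACondFrom? m (suc j) (y ∷ xs)

ACond : ℕ → List ℕ → Set
ACond m = ACondFrom m 1

A : ℕ → ℕ → ℕ
A m n = count (ACond m) (ACondFrom? m 1) n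

module Submission where

-- Call a strictly decreasing list of type a if its 1st, 3rd, 5th, … parts avoid 1 and its other parts
-- avoid 2 modulo 3, of type b if it is the other way round, always without consecutive parts 3l+2, 3l+1.
-- For m = 1 the partitions counted by A are those of type a, for m = 2 those of type b.
-- Put Q = q³ and let X(a, b, N) be the generating function for type a with parts at most 3N, where
-- a = q², b = q; type b has X(b, a, N). Removing the parts above 3N from a list with parts at most 3N + 3 gives
--   X(a, b, N+1) = (1 + b Q^(2N+1)) X(a, b, N) + (Q + a) Q^N X(b, a, N),
-- which makes sense for all a and b, and induction on N yields the contiguity relation
--   (1 + a) X(bQ, aQ, N) = X(a, b, N) + a Q^N X(b, a, N).
-- Modulo Q^N it reads X(a, b, N) ≡ (1 + a) X(bQ, aQ, N); iterating it leads to
--   X(a, b, N) ≡ ∏ (1 + a Q^(2j)) (1 + b Q^(2j+1)) · X(0, 0, N),  X(0, 0, N) = ∏_{j ≤ N} (1 + Q^j),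
-- the generating function for distinct parts not congruent to ±m modulo 6.
-- Power series are replaced by their values at one large integer q, whose base-q digits are the coefficients.

open import Defs
open import Data.Bool.Base using (Bool; true; false; not)
open import Data.Bool.Properties using (not-involutive)
open import Data.Empty using (⊥; ⊥-elim)
open import Data.Integer as ℤ using () renaming (+_ to pos)
import Data.Integer.Divisibility as ℤD
import Data.Integer.Divisibility.Signed as Signed
import Data.Integer.Properties as ℤP
import Data.Integer.Tactic.RingSolver as ℤSolver
open import Data.List using (List; []; _∷_; _++_; map; length; filter; concatMap; applyUpTo)
open import Data.List.Properties using (map-++; ∷-injectiveʳ)
open import Data.List.Membership.Propositional using (_∈_; lose; find)
open import Data.List.Membership.Propositional.Properties
open import Data.List.Membership.Propositional.Properties.WithK using (unique∧set⇒bag)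
open import Data.List.Relation.Binary.BagAndSetEquality using (∼bag⇒↭)
open import Data.List.Relation.Binary.Permutation.Propositional.Properties using (↭-length)
open import Data.List.Relation.Unary.All as All using (All; []; _∷_; all?)
import Data.List.Relation.Unary.All.Properties as AllP
open import Data.List.Relation.Unary.AllPairs as AllPairs using (AllPairs; []; _∷_)
import Data.List.Relation.Unary.AllPairs.Properties as AllPairsP
open import Data.List.Relation.Unary.Any using (here; there)
open import Data.List.Relation.Unary.Linked as Linked using (Linked; []; [-]; _∷_)
open import Data.List.Relation.Unary.Linked.Properties using (AllPairs⇒Linked; Linked⇒AllPairs)
open import Data.List.Relation.Unary.Unique.Propositional using (Unique)
import Data.List.Relation.Unary.Unique.Propositional.Properties as Unique
open import Data.Nat using (ℕ; zero; suc; _+_; _*_; _^_; _≤_; _<_; _≥_; _>_; _≟_; _≡ᵇ_; z≤n; s≤s)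
open import Data.Nat.Divisibility using (_∣?_; _∣0; ∣-refl)
open import Data.Nat.DivMod using (_%_; m<n⇒m%n≡m; [m+kn]%n≡m%n)
open import Data.Nat.ListAction using (sum; product)
open import Data.Nat.ListAction.Properties using (sum-++)
open import Data.Nat.Properties hiding (_≟_)
open import Data.Nat.Tactic.RingSolver using (solve-∀)
open import Data.Product using (_×_; _,_; proj₁; proj₂; ∃-syntax)
open import Data.Sum using (_⊎_; inj₁; inj₂)
open import Data.Unit using (⊤; tt)
open import Function using (_∘_; mk⇔)
open import Relation.Nullary using (¬_; yes; no; ¬?)
open import Relation.Nullary.Decidable using (from-no; from-yes; _×-dec_)
open import Relation.Binary.PropositionalEquality

-- Reading off coefficients

gf : ℕ → List ℕ → ℕ
gf q xs = sum (map (q ^_) xs)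

occ : ℕ → List ℕ → ℕ
occ n xs = length (filter (_≟ n) xs)

-- For an exponent list this subtracts the constant term of the polynomial and divides by q, so it
-- strips the lowest base-q digit.
lower : List ℕ → List ℕ
lower []           = []
lower (zero ∷ xs)  = lower xs
lower (suc x ∷ xs) = x ∷ lower xs

length-lower : ∀ xs → length (lower xs) ≤ length xs
length-lower []           = z≤n
length-lower (zero ∷ xs)  = m≤n⇒m≤1+n (length-lower xs)
length-lower (suc x ∷ xs) = s≤s (length-lower xs)

occ-zero≤length : ∀ xs → occ 0 xs ≤ length xs
occ-zero≤length []           = z≤n
occ-zero≤length (zero ∷ xs)  = s≤s (occ-zero≤length xs)
occ-zero≤length (suc x ∷ xs) = m≤n⇒m≤1+n (occ-zero≤length xs)

occ-suc : ∀ n xs → occ (suc n) xs ≡ occ n (lower xs)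
occ-suc n []          = refl
occ-suc n (zero ∷ xs) = occ-suc n xs
occ-suc n (suc x ∷ xs) with x ≡ᵇ n
... | true  = cong suc (occ-suc n xs)
... | false = occ-suc n xs

gf-split : ∀ q xs → gf q xs ≡ occ 0 xs + gf q (lower xs) * q
gf-split q []           = refl
gf-split q (zero ∷ xs)  = cong suc (gf-split q xs)
gf-split q (suc x ∷ xs) = trans (cong (q ^ suc x +_) (gf-split q xs))
  (lemma q (q ^ x) (occ 0 xs) (gf q (lower xs)))
  where
  lemma : ∀ q y c g → q * y + (c + g * q) ≡ c + (y + g) * q
  lemma = solve-∀

digit-unique : ∀ q {c d} r s → c < q → d < q → c + r * q ≡ d + s * q → c ≡ d × r ≡ s
digit-unique q@(suc _) {c} {d} r s c<q d<q eq = c≡d , *-cancelʳ-≡ r s q (+-cancelˡ-≡ c _ _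
    (trans eq (cong (_+ s * q) (sym c≡d))))
  where
  open ≡-Reasoning
  c≡d : c ≡ d
  c≡d = begin
    c               ≡⟨ m<n⇒m%n≡m c<q ⟨
    c % q           ≡⟨ [m+kn]%n≡m%n c r q ⟨
    (c + r * q) % q ≡⟨ cong (_% q) eq ⟩
    (d + s * q) % q ≡⟨ [m+kn]%n≡m%n d s q ⟩
    d % q           ≡⟨ m<n⇒m%n≡m d<q ⟩
    d               ∎

-- When q exceeds every coefficient, the coefficients are the base-q digits of the value at q.
occ-unique : ∀ q n xs ys u v → length xs < q → length ys < q →
  gf q xs + q ^ suc n * u ≡ gf q ys + q ^ suc n * v → occ n xs ≡ occ n ys
occ-unique q n xs ys u v xs<q ys<q eq = digits n digit₀
  where
  carry : ∀ xs k u → gf q xs + q ^ suc k * u ≡ occ 0 xs + (gf q (lower xs) + q ^ k * u) * q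
  carry xs k u = trans (cong (_+ q ^ suc k * u) (gf-split q xs))
    (lemma q (q ^ k) (occ 0 xs) (gf q (lower xs)) u)
    where
    lemma : ∀ q y c g u → c + g * q + q * y * u ≡ c + (g + y * u) * q
    lemma = solve-∀
  -- The exponent `suc n` keeps the extra terms divisible by q even for n = 0, so they cannot touch
  -- the lowest digit. After division by q the same situation remains with `q ^ n`.
  digit₀ : occ 0 xs ≡ occ 0 ys × gf q (lower xs) + q ^ n * u ≡ gf q (lower ys) + q ^ n * v
  digit₀ = digit-unique q _ _ (≤-<-trans (occ-zero≤length xs) xs<q) (≤-<-trans (occ-zero≤length ys) ys<q)
    (trans (sym (carry xs n u)) (trans eq (carry ys n v)))
  digits : ∀ n → occ 0 xs ≡ occ 0 ys × gf q (lower xs) + q ^ n * u ≡ gf q (lower ys) + q ^ n * v →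
    occ n xs ≡ occ n ys
  digits zero    (h , _) = h
  digits (suc n) (_ , t) = trans (occ-suc n xs) (trans
    (occ-unique q n (lower xs) (lower ys) u v (≤-<-trans (length-lower xs) xs<q)
      (≤-<-trans (length-lower ys) ys<q) t)
    (sym (occ-suc n ys)))

gf-++ : ∀ q xs ys → gf q (xs ++ ys) ≡ gf q xs + gf q ys
gf-++ q xs ys = trans (cong sum (map-++ (q ^_) xs ys)) (sum-++ (map (q ^_) xs) _)

weight : ℕ → List (List ℕ) → ℕ
weight q L = gf q (map sum L)

weight-++ : ∀ q L M → weight q (L ++ M) ≡ weight q L + weight q M
weight-++ q L M = trans (cong (gf q) (map-++ sum L M)) (gf-++ q (map sum L) _)

weight-∷ : ∀ q x L → weight q (map (x ∷_) L) ≡ q ^ x * weight q L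
weight-∷ q x []      = sym (*-zeroʳ (q ^ x))
weight-∷ q x (π ∷ L) = begin
  q ^ (x + sum π) + weight q (map (x ∷_) L)  ≡⟨ cong₂ _+_ (^-distribˡ-+-* q x (sum π)) (weight-∷ q x L) ⟩
  q ^ x * q ^ sum π + q ^ x * weight q L     ≡⟨ *-distribˡ-+ (q ^ x) _ _ ⟨
  q ^ x * (q ^ sum π + weight q L)           ∎
  where open ≡-Reasoning

-- The contiguity relation

-- With Q = q³, X Q (q²) q N and X Q q (q²) N enumerate the alternating lists of type true and
-- false (see Alternating) with parts at most 3N.
X : ℕ → ℕ → ℕ → ℕ → ℕ
X Q a b zero    = 1
X Q a b (suc N) = (1 + b * Q * (Q ^ N * Q ^ N)) * X Q a b N + (Q + a) * Q ^ N * X Q b a N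

-- In the recurrence for the shifted arguments the coefficient `Q + b * Q` is `Q * (1 + b)`. Its
-- factor `1 + b` is the one needed to use the induction hypothesis with a and b exchanged; what is
-- left is a polynomial identity.
X-shift : ∀ Q a b N → (1 + a) * X Q (b * Q) (a * Q) N ≡ X Q a b N + a * Q ^ N * X Q b a N
X-shift Q a b zero    = lemma a
  where
  lemma : ∀ a → (1 + a) * 1 ≡ 1 + a * 1 * 1
  lemma = solve-∀
X-shift Q a b (suc N) = begin
  (1 + a) * ((1 + a * Q * Q * (t * t)) * X Q (b * Q) (a * Q) N + (Q + b * Q) * t * X Q (a * Q) (b * Q) N)
    ≡⟨ regroup Q a b t (X Q (b * Q) (a * Q) N) (X Q (a * Q) (b * Q) N) ⟩
  (1 + a * Q * Q * (t * t)) * ((1 + a) * X Q (b * Q) (a * Q) N) + (1 + a) * Q * t * ((1 + b) * X Q (a * Q) (b * Q) N)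
    ≡⟨ cong₂ (λ u v → (1 + a * Q * Q * (t * t)) * u + (1 + a) * Q * t * v) (X-shift Q a b N) (X-shift Q b a N) ⟩
  (1 + a * Q * Q * (t * t)) * (X Q a b N + a * t * X Q b a N) + (1 + a) * Q * t * (X Q b a N + b * t * X Q a b N)
    ≡⟨ identity Q a b t (X Q a b N) (X Q b a N) ⟩
  _ ∎
  where
  open ≡-Reasoning
  t = Q ^ N
  regroup : ∀ Q a b t x y → (1 + a) * ((1 + a * Q * Q * (t * t)) * x + (Q + b * Q) * t * y) ≡
    (1 + a * Q * Q * (t * t)) * ((1 + a) * x) + (1 + a) * Q * t * ((1 + b) * y)
  regroup = solve-∀
  identity : ∀ Q a b t x y →
    (1 + a * Q * Q * (t * t)) * (x + a * t * y) + (1 + a) * Q * t * (y + b * t * x) ≡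
    (1 + b * Q * (t * t)) * x + (Q + a) * t * y + a * (Q * t) * ((1 + a * Q * (t * t)) * y + (Q + b) * t * x)
  identity = solve-∀

-- Iterating the contiguity relation to an infinite product, modulo a power of Q

infix 4 _⊑[_]_

-- A one-sided congruence modulo K; it avoids subtraction.
record _⊑[_]_ (a K c : ℕ) : Set where
  constructor excess
  field
    {quotient} : ℕ
    equality   : a + K * quotient ≡ c

⊑-trans : ∀ {K a b c} → a ⊑[ K ] b → b ⊑[ K ] c → a ⊑[ K ] c
⊑-trans {K} {a} (excess {u} refl) (excess {v} refl) = excess (lemma K a u v)
  where
  lemma : ∀ K a u v → a + K * (u + v) ≡ a + K * u + K * v
  lemma = solve-∀

⊑-*ˡ : ∀ {K a b} c → a ⊑[ K ] b → (c * a) ⊑[ K ] (c * b)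
⊑-*ˡ {K} {a} c (excess {u} refl) = excess (lemma K a c u)
  where
  lemma : ∀ K a c u → c * a + K * (c * u) ≡ c * (a + K * u)
  lemma = solve-∀

-- A single shift sends (a, b) to (bQ, aQ), so two shifts restore the order. Each error term
-- contains `Q ^ N`, a multiple of K.
X-double-shift : ∀ {K} Q a b N → (∃[ w ] Q ^ N ≡ K * w) →
  X Q a b N ⊑[ K ] ((1 + a) * (1 + b * Q) * X Q (a * (Q * Q)) (b * (Q * Q)) N)
X-double-shift {K} Q a b N (w , Q^N≡Kw) = ⊑-trans (single a b) (subst ((1 + a) * X Q (b * Q) (a * Q) N ⊑[ K ]_) reassoc
    (⊑-*ˡ (1 + a) (single (b * Q) (a * Q))))
  where
  single : ∀ a b → X Q a b N ⊑[ K ] ((1 + a) * X Q (b * Q) (a * Q) N)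
  single a b = excess (sym (trans (X-shift Q a b N)
    (trans (cong (λ t → X Q a b N + a * t * X Q b a N) Q^N≡Kw) (lemma K a w (X Q a b N) (X Q b a N)))))
    where
    lemma : ∀ K a w x y → x + a * (K * w) * y ≡ x + K * (a * w * y)
    lemma = solve-∀
  reassoc : (1 + a) * ((1 + b * Q) * X Q (a * Q * Q) (b * Q * Q) N) ≡
            (1 + a) * (1 + b * Q) * X Q (a * (Q * Q)) (b * (Q * Q)) N
  reassoc rewrite *-assoc a Q Q | *-assoc b Q Q = sym (*-assoc (1 + a) (1 + b * Q) _)

Π[_] : ℕ → (ℕ → ℕ) → ℕ
Π[ zero  ] f = 1
Π[ suc k ] f = f k * Π[ k ] f

X-iterated-shift : ∀ {K} Q a b N → (∃[ w ] Q ^ N ≡ K * w) → ∀ k →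
  X Q a b N ⊑[ K ] (Π[ k ] (λ j → (1 + a * (Q * Q) ^ j) * (1 + b * (Q * Q) ^ j * Q)) *
                    X Q (a * (Q * Q) ^ k) (b * (Q * Q) ^ k) N)
X-iterated-shift {K} Q a b N small zero    rewrite *-identityʳ a | *-identityʳ b = excess {quotient = 0} (lemma _ K)
  where
  lemma : ∀ x K → x + K * 0 ≡ 1 * x
  lemma = solve-∀
X-iterated-shift {K} Q a b N small (suc k) = ⊑-trans (X-iterated-shift Q a b N small k)
  (subst (P * X Q a′ b′ N ⊑[ K ]_) eq (⊑-*ˡ P (X-double-shift Q a′ b′ N small)))
  where
  P = Π[ k ] (λ j → (1 + a * (Q * Q) ^ j) * (1 + b * (Q * Q) ^ j * Q))
  a′ = a * (Q * Q) ^ k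
  b′ = b * (Q * Q) ^ k
  next : ∀ a Q y → a * y * (Q * Q) ≡ a * (Q * Q * y)
  next = solve-∀
  assoc : ∀ p c x → p * (c * x) ≡ c * p * x
  assoc = solve-∀
  eq : P * ((1 + a′) * (1 + b′ * Q) * X Q (a′ * (Q * Q)) (b′ * (Q * Q)) N) ≡
       (1 + a′) * (1 + b′ * Q) * P * X Q (a * (Q * Q) ^ suc k) (b * (Q * Q) ^ suc k) N
  eq rewrite next a Q ((Q * Q) ^ k) | next b Q ((Q * Q) ^ k) = assoc P ((1 + a′) * (1 + b′ * Q)) _

-- `X` is a polynomial in its two parameters with nonnegative coefficients. When both are multiples
-- of K, every term beyond the constant one is a multiple of K.
X-⊑ : ∀ Q K a b N → X Q 0 0 N ⊑[ K ] X Q (a * K) (b * K) N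
X-⊑ Q K a b zero    = excess {quotient = 0} (cong suc (*-zeroʳ K))
X-⊑ Q K a b (suc N) with X-⊑ Q K a b N | X-⊑ Q K b a N
... | excess {u} eq | excess {v} eq′ rewrite sym eq | sym eq′ = excess (lemma Q K a b (Q ^ N) (X Q 0 0 N) u v)
  where
  lemma : ∀ Q K a b t x u v → 1 * x + (Q + 0) * t * x +
    K * (b * Q * (t * t) * (x + K * u) + u + (Q + a * K) * t * v + a * t * x) ≡
    (1 + b * K * Q * (t * t)) * (x + K * u) + (Q + a * K) * t * (x + K * v)
  lemma = solve-∀

^-distribʳ-* : ∀ m n k → (m * n) ^ k ≡ m ^ k * n ^ k
^-distribʳ-* m n zero    = refl
^-distribʳ-* m n (suc k) = trans (cong (m * n *_) (^-distribʳ-* m n k)) (lemma m n (m ^ k) (n ^ k))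
  where
  lemma : ∀ m n x y → m * n * (x * y) ≡ m * x * (n * y)
  lemma = solve-∀

-- For a = b = 0 the recurrence only multiplies by 1 + Q^(N+1). The bound is even so that the
-- factors pair up as exponents 2j+1 and 2j+2.
X-zero : ∀ Q k → X Q 0 0 (k + k) ≡ Π[ k ] (λ j → (1 + Q * (Q * Q) ^ j) * (1 + Q * Q * (Q * Q) ^ j))
X-zero Q zero    = refl
X-zero Q (suc k) rewrite +-suc k k | X-zero Q k | ^-distribˡ-+-* Q k k | ^-distribʳ-* Q Q k
  = lemma Q (Q ^ k * Q ^ k) _
  where
  lemma : ∀ Q t p → 1 * (1 * p + (Q + 0) * t * p) + (Q + 0) * (Q * t) * (1 * p + (Q + 0) * t * p) ≡
     (1 + Q * t) * (1 + Q * Q * t) * p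
  lemma = solve-∀

Π-* : ∀ k f g → Π[ k ] f * Π[ k ] g ≡ Π[ k ] (λ j → f j * g j)
Π-* zero    f g = refl
Π-* (suc k) f g = trans (lemma (f k) (g k) _ _) (cong (f k * g k *_) (Π-* k f g))
  where
  lemma : ∀ f g x y → f * x * (g * y) ≡ f * g * (x * y)
  lemma = solve-∀

-- For Q = q³, a = `q ^ ω t`, b = `q ^ ω (not t)` these four factors belong to the parts from 6j+1
-- to 6j+6 that are allowed modulo 6.
block : ℕ → ℕ → ℕ → ℕ → ℕ
block Q a b j = (1 + a * (Q * Q) ^ j) * (1 + b * (Q * Q) ^ j * Q) *
                ((1 + Q * (Q * Q) ^ j) * (1 + Q * Q * (Q * Q) ^ j))

-- Both quantities are congruent to `Π[ M ] f * X Q (a * K) (b * K) (M + M)`. With N = 2M the number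
-- K = Q^(2M) is at once `Q ^ N`, the modulus of the errors, and the factor that M double shifts
-- bring to a and b.
X-product : ∀ Q a b M → ∃[ u ] ∃[ v ]
  X Q a b (M + M) + (Q * Q) ^ M * u ≡ Π[ M ] (block Q a b) + (Q * Q) ^ M * v
X-product Q a b M = _ , _ , trans (toLimit ._⊑[_]_.equality) (sym (fromProduct ._⊑[_]_.equality))
  where
  K = (Q * Q) ^ M
  f = λ j → (1 + a * (Q * Q) ^ j) * (1 + b * (Q * Q) ^ j * Q)
  toLimit : X Q a b (M + M) ⊑[ K ] (Π[ M ] f * X Q (a * K) (b * K) (M + M))
  toLimit = X-iterated-shift Q a b (M + M)
    (1 , trans (^-distribˡ-+-* Q M M) (trans (sym (^-distribʳ-* Q Q M)) (sym (*-identityʳ K)))) M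
  fromProduct : Π[ M ] (block Q a b) ⊑[ K ] (Π[ M ] f * X Q (a * K) (b * K) (M + M))
  fromProduct = subst (_⊑[ K ] Π[ M ] f * X Q (a * K) (b * K) (M + M)) (trans (cong (Π[ M ] f *_) (X-zero Q M)) (Π-* M f _))
    (⊑-*ˡ (Π[ M ] f) (X-⊑ Q K a b (M + M)))

-- Counting by enumeration

-- The label of a member recovers the x whose list it came from, so lists for different x are
-- disjoint.
concatMap-unique : ∀ {A B : Set} (f : A → List B) (label : B → A) → (∀ x {y} → y ∈ f x → label y ≡ x) →
  (∀ x → Unique (f x)) → ∀ {xs} → Unique xs → Unique (concatMap f xs)
concatMap-unique f label labels unique []         = []
concatMap-unique f label labels unique {x ∷ xs} (x∉xs ∷ u) =
  Unique.++⁺ (unique _) (concatMap-unique f label labels unique u) disjoint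
  where
  disjoint : ∀ {y} → y ∈ f x × y ∈ concatMap f xs → ⊥
  disjoint (y∈fx , y∈rest) with x′ , x′∈xs , y∈fx′ ← find (∈-concatMap⁻ f {xs = xs} y∈rest) =
    All.lookup x∉xs x′∈xs (trans (sym (labels _ y∈fx)) (labels x′ y∈fx′))

words-length : ∀ n k {π} → π ∈ words n k → length π ≡ k
words-length n zero    (here refl) = refl
words-length n (suc k) π∈
  with x , _ , π∈′ ← find (∈-concatMap⁻ (λ x → map (x ∷_) (words n k)) {xs = applyUpTo suc n} π∈)
  with _ , π′∈ , refl ← ∈-map⁻ (x ∷_) π∈′ = cong suc (words-length n k π′∈)

words-unique : ∀ n k → Unique (words n k)
words-unique n zero    = [] ∷ []
words-unique n (suc k) = concatMap-unique (λ x → map (x ∷_) (words n k)) head labels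
  (λ x → Unique.map⁺ ∷-injectiveʳ (words-unique n k))
  (Unique.applyUpTo⁺₁ suc n (λ i<j _ → <⇒≢ (s≤s i<j)))
  where
  head : List ℕ → ℕ
  head []      = 0
  head (x ∷ _) = x
  labels : ∀ x {π} → π ∈ map (x ∷_) (words n k) → head π ≡ x
  labels x π∈ with _ , _ , refl ← ∈-map⁻ (x ∷_) π∈ = refl

candidates-unique : ∀ n → Unique (candidates n)
candidates-unique n = concatMap-unique (words n) length (words-length n) (words-unique n) (Unique.upTo⁺ (suc n))

words-complete : ∀ n π → All (1 ≤_) π → All (_≤ n) π → π ∈ words n (length π)
words-complete n []          []         []            = here refl
words-complete n (suc x ∷ π) (_ ∷ 1≤π) (x<n ∷ π≤n) =
  ∈-concatMap⁺ (λ x → map (x ∷_) (words n (length π)))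
    (lose (∈-applyUpTo⁺ suc x<n) (∈-map⁺ (suc x ∷_) (words-complete n π 1≤π π≤n)))

length≤sum : ∀ {π} → All (1 ≤_) π → length π ≤ sum π
length≤sum []            = z≤n
length≤sum (1≤x ∷ 1≤π) = +-mono-≤ 1≤x (length≤sum 1≤π)

parts≤sum : ∀ π → All (_≤ sum π) π
parts≤sum []      = []
parts≤sum (x ∷ π) = m≤m+n x (sum π) ∷ All.map (λ y≤ → ≤-trans y≤ (m≤n+m (sum π) x)) (parts≤sum π)

candidates-complete : ∀ {n π} → IsPartition n π → π ∈ candidates n
candidates-complete {π = π} (_ , 1≤π , refl) = ∈-concatMap⁺ (words (sum π))
  (lose (∈-upTo⁺ (s≤s (length≤sum 1≤π))) (words-complete (sum π) π 1≤π (parts≤sum π)))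

occ-map-sum : ∀ n L → occ n (map sum L) ≡ length (filter (λ π → sum π ≟ n) L)
occ-map-sum n []      = refl
occ-map-sum n (π ∷ L) with sum π ≡ᵇ n
... | true  = cong suc (occ-map-sum n L)
... | false = occ-map-sum n L

-- Members of L may have any sum, and only completeness refers to n. Thus L can be a list with
-- bounded parts, whose generating function has a closed form.
record Enumerates (P : List ℕ → Set) (n : ℕ) (L : List (List ℕ)) : Set where
  field
    unique   : Unique L
    sound    : ∀ {π} → π ∈ L → IsPartition (sum π) π × P π
    complete : ∀ {π} → IsPartition n π → P π → π ∈ L

-- Two duplicate-free lists with the same members are permutations of each other.
count-enumerated : ∀ {P P? n L} → Enumerates P n L → count P P? n ≡ occ n (map sum L)
count-enumerated {P} {P?} {n} {L} E = trans
  (↭-length (∼bag⇒↭ (unique∧set⇒bag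
    (Unique.filter⁺ Q? (candidates-unique n)) (Unique.filter⁺ (λ π → sum π ≟ n) unique) (mk⇔ to from))))
  (sym (occ-map-sum n L))
  where
  open Enumerates E
  Q? = λ π → isPartition? n π ×-dec P? π
  to : ∀ {π} → π ∈ filter Q? (candidates n) → π ∈ filter (λ π → sum π ≟ n) L
  to π∈ with _ , part , p ← ∈-filter⁻ Q? {xs = candidates n} π∈ =
    ∈-filter⁺ (λ π → sum π ≟ n) (complete part p) (proj₂ (proj₂ part))
  from : ∀ {π} → π ∈ filter (λ π → sum π ≟ n) L → π ∈ filter Q? (candidates n)
  from π∈ with π∈L , refl ← ∈-filter⁻ (λ π → sum π ≟ n) {xs = L} π∈ =
    let part , p = sound π∈L in ∈-filter⁺ Q? (candidates-complete part) (part , p)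

-- Alternating lists

Head : (ℕ → Set) → List ℕ → Set
Head P []      = ⊤
Head P (x ∷ _) = P x

Head-map : ∀ {P Q : ℕ → Set} → (∀ {x} → P x → Q x) → ∀ π → Head P π → Head Q π
Head-map f []      _ = tt
Head-map f (x ∷ _) p = f p

-- The split by largest part: L holds the lists with all parts below x, M the tails of those that
-- start with x. Both sides of the theorem are enumerated by this one operation.
extend : ℕ → List (List ℕ) → List (List ℕ) → List (List ℕ)
extend x L M = L ++ map (x ∷_) M

extend-weight : ∀ q x L M → weight q (extend x L M) ≡ weight q L + q ^ x * weight q M
extend-weight q x L M = trans (weight-++ q L _) (cong (weight q L +_) (weight-∷ q x M))

extend-unique : ∀ x {L M} → Unique L → Unique M → (∀ {π} → π ∈ L → Head (_< x) π) → Unique (extend x L M)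
extend-unique x {L} {M} L! M! L<x = Unique.++⁺ L! (Unique.map⁺ ∷-injectiveʳ M!) disjoint
  where
  disjoint : ∀ {π} → π ∈ L × π ∈ map (x ∷_) M → ⊥
  disjoint (π∈L , π∈M) with _ , _ , refl ← ∈-map⁻ (x ∷_) π∈M = <-irrefl refl (L<x π∈L)

extend-⊆ : ∀ (P : List ℕ → Set) x {L M} → (∀ {π} → π ∈ L → P π) → (∀ {π} → π ∈ M → P (x ∷ π)) →
  ∀ {π} → π ∈ extend x L M → P π
extend-⊆ P x {L} inL inM π∈ with ∈-++⁻ L π∈
... | inj₁ π∈L = inL π∈L
... | inj₂ π∈M with _ , π′∈M , refl ← ∈-map⁻ (x ∷_) π∈M = inM π′∈M

extend-ˡ : ∀ x {L M π} → π ∈ L → π ∈ extend x L M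
extend-ˡ x = ∈-++⁺ˡ

extend-ʳ : ∀ x {L M π} → π ∈ M → (x ∷ π) ∈ extend x L M
extend-ʳ x {L} π∈M = ∈-++⁺ʳ L (∈-map⁺ (x ∷_) π∈M)

gap : Bool → ℕ
gap true  = 1
gap false = 0

-- `ω t` plays three roles at a position of type t: the residue modulo 3 permitted besides 0, the
-- least difference to the next part, and the exponent of q in the first parameter of `X`.
ω : Bool → ℕ
ω t = suc (gap t)

ω<3 : ∀ t → ω t < 3
ω<3 true  = s≤s (s≤s (s≤s z≤n))
ω<3 false = s≤s (s≤s z≤n)

ω-sum : ∀ t → ω t + ω (not t) ≡ 3
ω-sum true  = refl
ω-sum false = refl

-- Type true is type a, type false is type b; the gap ω t ≥ 1 also excludes the consecutive parts 3l+2, 3l+1.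
Alternating : Bool → List ℕ → Set
Alternating t []      = ⊤
Alternating t (x ∷ π) = (1 ≤ x × ¬ (pos x ≡₃ pos (ω (not t)))) × Head (λ y → ω t + y ≤ x) π × Alternating (not t) π

+-residue : ∀ r d k z → pos (r + d * k) ℤ.- z ≡ pos r ℤ.- z ℤ.+ pos d ℤ.* pos k
+-residue r d k z = trans (cong (λ w → pos r ℤ.+ w ℤ.- z) (ℤP.pos-* d k)) (regroup (pos r) (pos d ℤ.* pos k) z)
  where
  regroup : ∀ r w z → r ℤ.+ w ℤ.- z ≡ r ℤ.- z ℤ.+ w
  regroup = ℤSolver.solve-∀

residue-shift : ∀ d r k z → pos d ℤD.∣ (pos (r + d * k) ℤ.- z) → pos d ℤD.∣ (pos r ℤ.- z)
residue-shift d r k z h = Signed.∣⇒∣ᵤ (Signed.∣m+n∣n⇒∣m {m = pos r ℤ.- z}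
  (subst (pos d Signed.∣_) (+-residue r d k z) (Signed.∣ᵤ⇒∣ h)) (Signed.∣m⇒∣m*n (pos k) Signed.∣-refl))

residue-unshift : ∀ d r k z → pos d ℤD.∣ (pos r ℤ.- z) → pos d ℤD.∣ (pos (r + d * k) ℤ.- z)
residue-unshift d r k z h = Signed.∣⇒∣ᵤ (subst (pos d Signed.∣_) (sym (+-residue r d k z))
  (Signed.∣m∣n⇒∣m+n {m = pos r ℤ.- z} (Signed.∣ᵤ⇒∣ h) (Signed.∣m⇒∣m*n (pos k) Signed.∣-refl)))

-- The number tested for divisibility by 3 is the absolute difference of the two residues.
residue-own : ∀ t N → ¬ (pos (ω t + 3 * N) ≡₃ pos (ω (not t)))
residue-own true  N h = from-no (3 ∣? 1) (residue-shift 3 2 N (pos 1) h)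
residue-own false N h = from-no (3 ∣? 1) (residue-shift 3 1 N (pos 2) h)

residue-top : ∀ t N → ¬ (pos (3 * N) ≡₃ pos (ω (not t)))
residue-top true  N h = from-no (3 ∣? 1) (residue-shift 3 0 N (pos 1) h)
residue-top false N h = from-no (3 ∣? 2) (residue-shift 3 0 N (pos 2) h)

residue-other : ∀ t N → pos (ω (not t) + 3 * N) ≡₃ pos (ω (not t))
residue-other true  N = residue-unshift 3 1 N (pos 1) (3 ∣0)
residue-other false N = residue-unshift 3 2 N (pos 2) (3 ∣0)

-- `half t N` allows parts up to 3N + ω t. After a first part 3N + ω t the tail is bounded by 3N.
-- After 3N + 3 it is bounded by 3N + 3 - ω t = 3N + ω (not t), which is again the bound of a
-- `half`.
alternating half : Bool → ℕ → List (List ℕ)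
alternating t zero    = [] ∷ []
alternating t (suc N) = extend (3 * suc N) (half t N) (half (not t) N)
half t N = extend (ω t + 3 * N) (alternating t N) (alternating (not t) N)

half-weight : ∀ q t N → (∀ t → weight q (alternating t N) ≡ X (q ^ 3) (q ^ ω t) (q ^ ω (not t)) N) →
  weight q (half t N) ≡ X (q ^ 3) (q ^ ω t) (q ^ ω (not t)) N + q ^ ω t * (q ^ 3) ^ N * X (q ^ 3) (q ^ ω (not t)) (q ^ ω t) N
half-weight q t N ih = begin
  weight q (half t N)
    ≡⟨ extend-weight q (ω t + 3 * N) (alternating t N) _ ⟩
  weight q (alternating t N) + q ^ (ω t + 3 * N) * weight q (alternating (not t) N)
    ≡⟨ cong₂ _+_ (ih t) (cong₂ _*_
         (trans (^-distribˡ-+-* q (ω t) (3 * N)) (cong (q ^ ω t *_) (sym (^-*-assoc q 3 N))))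
         (trans (ih (not t)) (cong (λ s → X (q ^ 3) (q ^ ω (not t)) (q ^ ω s) N) (not-involutive t)))) ⟩
  _ ∎
  where open ≡-Reasoning

alternating-weight : ∀ q t N → weight q (alternating t N) ≡ X (q ^ 3) (q ^ ω t) (q ^ ω (not t)) N
alternating-weight q t zero    = refl
alternating-weight q t (suc N) = begin
  weight q (alternating t (suc N))
    ≡⟨ extend-weight q (3 * suc N) (half t N) _ ⟩
  weight q (half t N) + q ^ (3 * suc N) * weight q (half (not t) N)
    ≡⟨ cong₂ _+_ (half-weight q t N ih) (cong₂ _*_ (sym (^-*-assoc q 3 (suc N))) (trans (half-weight q (not t) N ih)
         (cong (λ s → X Q b (q ^ ω s) N + b * Q ^ N * X Q (q ^ ω s) b N) (not-involutive t)))) ⟩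
  -- The product of `Q * Q ^ N` and `b * Q ^ N` counts the lists that start with 3N + 3, 3N + ω (not
  -- t); it becomes the term `b * Q * (Q ^ N * Q ^ N)` of the recurrence.
  X Q a b N + a * Q ^ N * X Q b a N + Q * Q ^ N * (X Q b a N + b * Q ^ N * X Q a b N)
    ≡⟨ regroup Q a b (Q ^ N) (X Q a b N) (X Q b a N) ⟩
  _ ∎
  where
  open ≡-Reasoning
  Q = q ^ 3
  a = q ^ ω t
  b = q ^ ω (not t)
  ih = λ t → alternating-weight q t N
  regroup : ∀ Q a b t x y → x + a * t * y + Q * t * (y + b * t * x) ≡
    (1 + b * Q * (t * t)) * x + (Q + a) * t * y
  regroup = solve-∀

AlternatingUpTo : Bool → ℕ → List ℕ → Set
AlternatingUpTo t n π = Alternating t π × Head (_≤ n) π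

3*suc : ∀ N → 3 * suc N ≡ 3 + 3 * N
3*suc = solve-∀

upTo-weaken : ∀ {t m n π} → m ≤ n → AlternatingUpTo t m π → AlternatingUpTo t n π
upTo-weaken {π = π} m≤n (alt , hd) = alt , Head-map (λ x≤ → ≤-trans x≤ m≤n) π hd

half-sound : ∀ t N → (∀ t {π} → π ∈ alternating t N → AlternatingUpTo t (3 * N) π) →
  ∀ {π} → π ∈ half t N → AlternatingUpTo t (ω t + 3 * N) π
half-sound t N ih = extend-⊆ (AlternatingUpTo t (ω t + 3 * N)) (ω t + 3 * N)
  (upTo-weaken (m≤n+m (3 * N) (ω t)) ∘ ih t) cons
  where
  cons : ∀ {π} → π ∈ alternating (not t) N → AlternatingUpTo t (ω t + 3 * N) (ω t + 3 * N ∷ π)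
  cons {π} π∈ with alt , hd ← ih (not t) π∈ =
    ((s≤s z≤n , residue-own t N) , Head-map (+-monoʳ-≤ (ω t)) π hd , alt) , ≤-refl

alternating-sound : ∀ t N {π} → π ∈ alternating t N → AlternatingUpTo t (3 * N) π
alternating-sound t zero    (here refl) = tt , tt
alternating-sound t (suc N) = extend-⊆ (AlternatingUpTo t (3 * suc N)) (3 * suc N)
  (upTo-weaken bound ∘ half-sound t N ih) cons
  where
  ih = λ t {π} → alternating-sound t N {π}
  bound : ω t + 3 * N ≤ 3 * suc N
  bound = ≤-trans (+-monoˡ-≤ (3 * N) (<⇒≤ (ω<3 t))) (≤-reflexive (sym (3*suc N)))
  fits : ∀ {y} → y ≤ ω (not t) + 3 * N → ω t + y ≤ 3 * suc N
  fits {y} y≤ = begin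
    ω t + y                       ≤⟨ +-monoʳ-≤ (ω t) y≤ ⟩
    ω t + (ω (not t) + 3 * N)     ≡⟨ +-assoc (ω t) (ω (not t)) (3 * N) ⟨
    ω t + ω (not t) + 3 * N       ≡⟨ cong (_+ 3 * N) (ω-sum t) ⟩
    3 + 3 * N                     ≡⟨ 3*suc N ⟨
    3 * suc N                     ∎
    where open ≤-Reasoning
  cons : ∀ {π} → π ∈ half (not t) N → AlternatingUpTo t (3 * suc N) (3 * suc N ∷ π)
  cons {π} π∈ with alt , hd ← half-sound (not t) N ih π∈ =
    ((s≤s z≤n , residue-top t (suc N)) , Head-map fits π hd , alt) , ≤-refl

alternating-unique : ∀ t N → Unique (alternating t N)
alternating-unique t zero    = [] ∷ []
alternating-unique t (suc N) = extend-unique (3 * suc N) (half-unique t) (half-unique (not t))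
  (λ {π} → Head-map (λ x≤ → ≤-trans (s≤s x≤)
    (≤-trans (+-monoˡ-< (3 * N) (ω<3 t)) (≤-reflexive (sym (3*suc N))))) π ∘ proj₂ ∘ half-sound t N ih)
  where
  ih = λ t {π} → alternating-sound t N {π}
  half-unique : ∀ t → Unique (half t N)
  half-unique t = extend-unique (ω t + 3 * N) (alternating-unique t N) (alternating-unique (not t) N)
    (λ {π} → Head-map (λ x≤ → s≤s (≤-trans x≤ (m≤n+m (3 * N) (gap t)))) π ∘ proj₂ ∘ ih t)

-- The middle case arises only for ω t = 2, and in `below-top` only for ω t = 1. In both it is the
-- value that the residue condition forbids for a first part of type t.
below-half : ∀ t N {x} → x ≤ ω t + 3 * N → x ≤ 3 * N ⊎ x ≡ ω (not t) + 3 * N ⊎ x ≡ ω t + 3 * N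
below-half t N x≤ with m≤n⇒m<n∨m≡n x≤
below-half t     N x≤ | inj₂ eq = inj₂ (inj₂ eq)
below-half false N x≤ | inj₁ (s≤s x<) = inj₁ x<
below-half true  N x≤ | inj₁ (s≤s x<) with m≤n⇒m<n∨m≡n x<
... | inj₁ (s≤s x<′) = inj₁ x<′
... | inj₂ eq        = inj₂ (inj₁ eq)

below-top : ∀ t N {x} → x ≤ 3 + 3 * N → x ≤ ω t + 3 * N ⊎ x ≡ ω (not t) + 3 * N ⊎ x ≡ 3 + 3 * N
below-top t N x≤ with m≤n⇒m<n∨m≡n x≤
below-top t     N x≤ | inj₂ eq = inj₂ (inj₂ eq)
below-top true  N x≤ | inj₁ (s≤s x<) = inj₁ x<
below-top false N x≤ | inj₁ (s≤s x<) with m≤n⇒m<n∨m≡n x<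
... | inj₁ (s≤s x<′) = inj₁ x<′
... | inj₂ eq        = inj₂ (inj₁ eq)

half-complete : ∀ t N → (∀ t {π} → AlternatingUpTo t (3 * N) π → π ∈ alternating t N) →
  ∀ {π} → AlternatingUpTo t (ω t + 3 * N) π → π ∈ half t N
half-complete t N ih {[]}    _ = extend-ˡ (ω t + 3 * N) (ih t (tt , tt))
half-complete t N ih {x ∷ π} (alt@((_ , ok) , hd , alt′) , x≤) with below-half t N x≤
... | inj₁ x≤3N         = extend-ˡ (ω t + 3 * N) (ih t (alt , x≤3N))
... | inj₂ (inj₁ refl)  = ⊥-elim (ok (residue-other t N))
... | inj₂ (inj₂ refl)  = extend-ʳ (ω t + 3 * N) (ih (not t) (alt′ , Head-map (+-cancelˡ-≤ (ω t) _ _) π hd))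

alternating-complete : ∀ t N {π} → AlternatingUpTo t (3 * N) π → π ∈ alternating t N
alternating-complete t zero {[]}      _ = here refl
alternating-complete t zero {x ∷ π} (((1≤x , _) , _) , x≤0) with () ← ≤-trans 1≤x x≤0
alternating-complete t (suc N) {[]}   _ =
  extend-ˡ (3 * suc N) (half-complete t N (λ t → alternating-complete t N) (tt , tt))
alternating-complete t (suc N) {x ∷ π} (alt@((_ , ok) , hd , alt′) , x≤) with below-top t N (subst (x ≤_) (3*suc N) x≤)
... | inj₁ x≤half       = extend-ˡ (3 * suc N) (half-complete t N (λ t → alternating-complete t N) (alt , x≤half))
... | inj₂ (inj₁ refl)  = ⊥-elim (ok (residue-other t N))
... | inj₂ (inj₂ eq) with refl ← trans eq (sym (3*suc N)) =
  extend-ʳ (3 * suc N) (half-complete (not t) N (λ t → alternating-complete t N) (alt′ , Head-map fits π hd))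
  where
  fits : ∀ {y} → ω t + y ≤ 3 * suc N → y ≤ ω (not t) + 3 * N
  fits {y} h = +-cancelˡ-≤ (ω t) _ _ (≤-trans h (≤-reflexive (trans (3*suc N)
    (trans (cong (_+ 3 * N) (sym (ω-sum t))) (+-assoc (ω t) (ω (not t)) (3 * N))))))

-- From conditions on indices to alternating types

odd : ℕ → Bool
odd zero    = false
odd (suc j) = not (odd j)

%2≡odd : ∀ j → j % 2 ≡ gap (odd j)
%2≡odd zero          = refl
%2≡odd (suc zero)    = refl
%2≡odd (suc (suc j)) = trans (%2≡odd j) (cong gap (sym (not-involutive (odd j))))

<-⇒+-≤ : ∀ {g x y} → pos g ℤ.< pos x ℤ.- pos y → suc g + y ≤ x
<-⇒+-≤ {g} {x} {y} h = ℤP.drop‿+<+ (subst (pos (g + y) ℤ.<_) (cancel (pos x) (pos y)) (ℤP.+-monoˡ-< (pos y) h))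
  where
  cancel : ∀ x y → x ℤ.- y ℤ.+ y ≡ x
  cancel = ℤSolver.solve-∀

+-≤⇒< : ∀ {g x y} → suc g + y ≤ x → pos g ℤ.< pos x ℤ.- pos y
+-≤⇒< {g} {x} {y} h = subst (ℤ._< pos x ℤ.- pos y) (cancel (pos g) (pos y)) (ℤP.+-monoˡ-< (ℤ.- pos y) (ℤ.+<+ h))
  where
  cancel : ∀ x y → x ℤ.+ y ℤ.- y ≡ x
  cancel = ℤSolver.solve-∀

-- `type j` is the type of the position with index j: `odd` for m = 1 and its negation for m = 2.
-- The values of `resA` are then exactly 1 or 2, and the strict bound `gapA` turns into a difference
-- of at least `ω`.
module _ (m : ℕ) (type : ℕ → Bool) (type-suc : ∀ j → type (suc j) ≡ not (type j))
  (res : ∀ j → resA m (j % 2) ≡ pos (ω (not (type j)))) (gapEq : ∀ j → gapA m (j % 2) ≡ pos (gap (type j))) where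

  ACond⇒Alternating : ∀ j {π} → All (1 ≤_) π → ACondFrom m j π → Alternating (type j) π
  ACond⇒Alternating j {[]}         _           _  = tt
  ACond⇒Alternating j {x ∷ []}     (1≤x ∷ _)   ok rewrite res j = (1≤x , ok) , tt , tt
  ACond⇒Alternating j {x ∷ y ∷ π} (1≤x ∷ 1≤π) (ok , gp , rest)
    rewrite res j | gapEq j | sym (type-suc j) =
    (1≤x , ok) , <-⇒+-≤ gp , ACond⇒Alternating (suc j) 1≤π rest

  Alternating⇒ACond : ∀ j {π} → Alternating (type j) π → ACondFrom m j π
  Alternating⇒ACond j {[]}        _ = tt
  Alternating⇒ACond j {x ∷ []}    ((_ , ok) , _) rewrite res j = ok
  Alternating⇒ACond j {x ∷ y ∷ π} ((_ , ok) , hd , rest)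
    = ok ∘ subst (pos x ≡₃_) (res j) , subst (ℤ._< pos x ℤ.- pos y) (sym (gapEq j)) (+-≤⇒< hd) ,
      Alternating⇒ACond (suc j) (subst (λ t → Alternating t (y ∷ π)) (sym (type-suc j)) rest)

Alternating⇒Linked : ∀ t π → Alternating t π → Linked _≥_ π
Alternating⇒Linked t []          _ = []
Alternating⇒Linked t (x ∷ [])    _ = [-]
Alternating⇒Linked t (x ∷ y ∷ π) (_ , hd , rest) =
  ≤-trans (m≤n+m y (ω t)) hd ∷ Alternating⇒Linked (not t) (y ∷ π) rest

Alternating⇒positive : ∀ t π → Alternating t π → All (1 ≤_) π
Alternating⇒positive t []      _ = []
Alternating⇒positive t (x ∷ π) ((1≤x , _) , _ , rest) = 1≤x ∷ Alternating⇒positive (not t) π rest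

alternating-enumerates : ∀ m t {n} N → n ≤ 3 * N → (∀ {π} → All (1 ≤_) π → ACond m π → Alternating t π) →
  (∀ {π} → Alternating t π → ACond m π) → Enumerates (ACond m) n (alternating t N)
alternating-enumerates m t N n≤3N to from = record
  { unique   = alternating-unique t N
  ; sound    = λ {π} π∈ → let alt , _ = alternating-sound t N π∈ in
      (Alternating⇒Linked t π alt , Alternating⇒positive t π alt , refl) , from alt
  ; complete = λ { {π} (_ , 1≤π , refl) cond → alternating-complete t N (to 1≤π cond , head≤ π (parts≤sum π) n≤3N) }
  }
  where
  head≤ : ∀ π {n k} → All (_≤ n) π → n ≤ k → Head (_≤ k) π
  head≤ []      _          _   = tt
  head≤ (x ∷ _) (x≤n ∷ _) n≤k = ≤-trans x≤n n≤k

A₁-enumerates : ∀ {n} N → n ≤ 3 * N → Enumerates (ACond 1) n (alternating true N)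
A₁-enumerates N n≤3N = alternating-enumerates 1 true N n≤3N
  (ACond⇒Alternating 1 odd (λ _ → refl) res gp 1) (Alternating⇒ACond 1 odd (λ _ → refl) res gp 1)
  where
  res : ∀ j → resA 1 (j % 2) ≡ pos (ω (not (odd j)))
  res j rewrite %2≡odd j with odd j
  ... | true  = refl
  ... | false = refl
  gp : ∀ j → gapA 1 (j % 2) ≡ pos (gap (odd j))
  gp j rewrite %2≡odd j with odd j
  ... | true  = refl
  ... | false = refl

A₂-enumerates : ∀ {n} N → n ≤ 3 * N → Enumerates (ACond 2) n (alternating false N)
A₂-enumerates N n≤3N = alternating-enumerates 2 false N n≤3N
  (ACond⇒Alternating 2 (not ∘ odd) (λ _ → refl) res gp 1) (Alternating⇒ACond 2 (not ∘ odd) (λ _ → refl) res gp 1)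
  where
  res : ∀ j → resA 2 (j % 2) ≡ pos (ω (not (not (odd j))))
  res j rewrite %2≡odd j with odd j
  ... | true  = refl
  ... | false = refl
  gp : ∀ j → gapA 2 (j % 2) ≡ pos (gap (not (odd j)))
  gp j rewrite %2≡odd j with odd j
  ... | true  = refl
  ... | false = refl

-- Distinct parts

distinct : List ℕ → List (List ℕ)
distinct []       = [] ∷ []
distinct (p ∷ ps) = extend p (distinct ps) (distinct ps)

distinct-sound : ∀ {ps} → AllPairs _>_ ps → ∀ {π} → π ∈ distinct ps → AllPairs _>_ π × All (_∈ ps) π
distinct-sound []               (here refl) = [] , []
distinct-sound {p ∷ ps} (p> ∷ ps>) = extend-⊆ (λ π → AllPairs _>_ π × All (_∈ p ∷ ps) π) p
  (λ π∈ → let π> , π∈ps = distinct-sound ps> π∈ in π> , All.map there π∈ps)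
  (λ π∈ → let π> , π∈ps = distinct-sound ps> π∈ in
    All.map (All.lookup p>) π∈ps ∷ π> , here refl ∷ All.map there π∈ps)

distinct-unique : ∀ {ps} → AllPairs _>_ ps → Unique (distinct ps)
distinct-unique []                 = [] ∷ []
distinct-unique {p ∷ ps} (p> ∷ ps>) = extend-unique p (distinct-unique ps>) (distinct-unique ps>)
  (head< ∘ proj₂ ∘ distinct-sound ps>)
  where
  head< : ∀ {π} → All (_∈ ps) π → Head (_< p) π
  head< []          = tt
  head< (x∈ps ∷ _) = All.lookup p> x∈ps

distinct-complete : ∀ {ps} → AllPairs _>_ ps → ∀ {π} → AllPairs _>_ π → All (_∈ ps) π → π ∈ distinct ps
distinct-complete []                   []         []  = here refl
distinct-complete {p ∷ ps} (p> ∷ ps>) {[]}    _ _ = extend-ˡ p (distinct-complete ps> [] [])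
distinct-complete {p ∷ ps} (p> ∷ ps>) {x ∷ π} (x> ∷ π>) (x∈ ∷ π∈) = case-head x∈
  where
  drop-head : ∀ {y} → y < p × y ∈ p ∷ ps → y ∈ ps
  drop-head (y<p , here refl)  = ⊥-elim (<-irrefl refl y<p)
  drop-head (_   , there y∈ps) = y∈ps
  case-head : x ∈ p ∷ ps → (x ∷ π) ∈ distinct (p ∷ ps)
  case-head (here refl)  = extend-ʳ p (distinct-complete ps> π> (All.zipWith drop-head (x> , π∈)))
  -- Here x < p, so all later parts are below p too and none of them equals p.
  case-head (there x∈ps) = extend-ˡ p (distinct-complete ps> (x> ∷ π>)
    (x∈ps ∷ All.zipWith drop-head (All.map (λ y<x → <-trans y<x (All.lookup p> x∈ps)) x> , π∈)))

Allowed : ℕ → ℕ → Set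
Allowed m x = ¬ (pos x ≡₆ pos m) × ¬ (pos x ≡₆ (ℤ.- pos m))

allowed-shift : ∀ m r k → Allowed m r → Allowed m (r + 6 * k)
allowed-shift m r k (≢m , ≢-m) = ≢m ∘ residue-shift 6 r k (pos m) , ≢-m ∘ residue-shift 6 r k (ℤ.- pos m)

allowed-unshift : ∀ m r k → Allowed m (r + 6 * k) → Allowed m r
allowed-unshift m r k (≢m , ≢-m) = ≢m ∘ residue-unshift 6 r k (pos m) , ≢-m ∘ residue-unshift 6 r k (ℤ.- pos m)

-- With m = `ω (not t)` the excluded residues are m and 6 - m = 3 + ω t. The multiples of 6 are
-- represented by 6 instead of 0 to keep all parts positive.
residues : Bool → List ℕ
residues t = 6 ∷ 3 + ω (not t) ∷ 3 ∷ ω t ∷ []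

residues-allowed : ∀ t → All (Allowed (ω (not t))) (residues t)
residues-allowed true  = from-yes (all? (λ x → ¬? (pos x ≡₆? pos 1) ×-dec ¬? (pos x ≡₆? (ℤ.- pos 1))) (residues true))
residues-allowed false = from-yes (all? (λ x → ¬? (pos x ≡₆? pos 2) ×-dec ¬? (pos x ≡₆? (ℤ.- pos 2))) (residues false))

allowed-residue : ∀ t {r} → 1 ≤ r → r ≤ 6 → Allowed (ω (not t)) r → r ∈ residues t
allowed-residue true  {1} _ _ (≢m , _)  = ⊥-elim (≢m (6 ∣0))
allowed-residue true  {2} _ _ _         = there (there (there (here refl)))
allowed-residue true  {3} _ _ _         = there (there (here refl))
allowed-residue true  {4} _ _ _         = there (here refl)
allowed-residue true  {5} _ _ (_ , ≢-m) = ⊥-elim (≢-m ∣-refl)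
allowed-residue true  {6} _ _ _         = here refl
allowed-residue false {1} _ _ _         = there (there (there (here refl)))
allowed-residue false {2} _ _ (≢m , _)  = ⊥-elim (≢m (6 ∣0))
allowed-residue false {3} _ _ _         = there (there (here refl))
allowed-residue false {4} _ _ (_ , ≢-m) = ⊥-elim (≢-m ∣-refl)
allowed-residue false {5} _ _ _         = there (here refl)
allowed-residue false {6} _ _ _         = here refl
allowed-residue _ {suc (suc (suc (suc (suc (suc (suc _))))))} _ (s≤s (s≤s (s≤s (s≤s (s≤s (s≤s ())))))) _

parts : Bool → ℕ → List ℕ
parts t zero    = []
parts t (suc k) = map (_+ 6 * k) (residues t) ++ parts t k

6*suc : ∀ k → 6 * suc k ≡ 6 + 6 * k
6*suc = solve-∀

residues-decreasing : ∀ t → AllPairs _>_ (residues t)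
residues-decreasing true  = from-yes (AllPairs.allPairs? _>?_ (residues true))
residues-decreasing false = from-yes (AllPairs.allPairs? _>?_ (residues false))

residues-bounds : ∀ t → All (λ r → 1 ≤ r × r ≤ 6) (residues t)
residues-bounds true  = from-yes (all? (λ r → 1 ≤? r ×-dec r ≤? 6) (residues true))
residues-bounds false = from-yes (all? (λ r → 1 ≤? r ×-dec r ≤? 6) (residues false))

parts-positive : ∀ t k → All (1 ≤_) (parts t k)
parts-positive t zero    = []
parts-positive t (suc k) = AllP.++⁺
  (AllP.map⁺ (All.map (λ {r} (1≤r , _) → ≤-trans 1≤r (m≤m+n r (6 * k))) (residues-bounds t))) (parts-positive t k)

parts-bounded : ∀ t k → All (_≤ 6 * k) (parts t k)
parts-bounded t zero    = []
parts-bounded t (suc k) rewrite 6*suc k = AllP.++⁺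
  (AllP.map⁺ (All.map (λ (_ , r≤6) → +-monoˡ-≤ (6 * k) r≤6) (residues-bounds t)))
  (All.map (λ x≤ → ≤-trans x≤ (m≤n+m (6 * k) 6)) (parts-bounded t k))

parts-allowed : ∀ t k → All (Allowed (ω (not t))) (parts t k)
parts-allowed t zero    = []
parts-allowed t (suc k) = AllP.++⁺
  (AllP.map⁺ (All.map (λ {r} → allowed-shift (ω (not t)) r k) (residues-allowed t))) (parts-allowed t k)

parts-decreasing : ∀ t k → AllPairs _>_ (parts t k)
parts-decreasing t zero    = []
parts-decreasing t (suc k) = AllPairsP.++⁺
  (AllPairsP.map⁺ (AllPairs.map (+-monoˡ-< (6 * k)) (residues-decreasing t))) (parts-decreasing t k)
  (AllP.map⁺ (All.map (λ (1≤r , _) → All.map (λ x≤ → +-mono-≤ 1≤r x≤) (parts-bounded t k)) (residues-bounds t)))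

parts-complete : ∀ t k {x} → 1 ≤ x → x ≤ 6 * k → Allowed (ω (not t)) x → x ∈ parts t k
parts-complete t zero    1≤x x≤0 _ with () ← ≤-trans 1≤x x≤0
parts-complete t (suc k) {x} 1≤x x≤ ok with x ≤? 6 * k
... | yes x≤6k = ∈-++⁺ʳ (map (_+ 6 * k) (residues t)) (parts-complete t k 1≤x x≤6k ok)
... | no  x≰6k with r , eq ← m≤n⇒∃[o]m+o≡n (<⇒≤ (≰⇒> x≰6k)) with refl ← trans (sym eq) (+-comm (6 * k) r) =
  ∈-++⁺ˡ (∈-map⁺ (_+ 6 * k)
  (allowed-residue t (+-cancelʳ-≤ (6 * k) 1 r (≰⇒> x≰6k)) (+-cancelʳ-≤ (6 * k) r 6 (subst (r + 6 * k ≤_) (6*suc k) x≤))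
    (allowed-unshift (ω (not t)) r k ok)))

C-enumerates : ∀ t {n} k → n ≤ 6 * k → Enumerates (CCond (ω (not t))) n (distinct (parts t k))
C-enumerates t k n≤6k = record
  { unique   = distinct-unique (parts-decreasing t k)
  ; sound    = λ π∈ → let π> , π∈parts = distinct-sound (parts-decreasing t k) π∈ in
      (Linked.map <⇒≤ (AllPairs⇒Linked π>) , All.map (All.lookup (parts-positive t k)) π∈parts , refl) ,
      (AllPairs.map (λ y<x x≡y → <⇒≢ y<x (sym x≡y)) π> , All.map (All.lookup (parts-allowed t k)) π∈parts)
  ; complete = λ { {π} (π≥ , 1≤π , refl) (π! , ok) → distinct-complete (parts-decreasing t k)
      (AllPairs.zipWith (λ (y≤x , x≢y) → ≤∧≢⇒< y≤x (x≢y ∘ sym)) (Linked⇒AllPairs (λ y≤x z≤y → ≤-trans z≤y y≤x) π≥ , π!))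
      (All.zipWith (λ { ((1≤x , x≤n) , okx) → parts-complete t k 1≤x (≤-trans x≤n n≤6k) okx })
        (All.zip (1≤π , parts≤sum π) , ok)) }
  }

distinct-weight : ∀ q ps → weight q (distinct ps) ≡ product (map (λ p → 1 + q ^ p) ps)
distinct-weight q []       = refl
distinct-weight q (p ∷ ps) = trans (extend-weight q p (distinct ps) (distinct ps))
  (cong ((1 + q ^ p) *_) (distinct-weight q ps))

parts-product : ∀ q t k →
  product (map (λ p → 1 + q ^ p) (parts t k)) ≡ Π[ k ] (block (q ^ 3) (q ^ ω t) (q ^ ω (not t)))
parts-product q t zero    = refl
parts-product q t (suc k) = begin
  (1 + q ^ (6 + 6 * k)) * ((1 + q ^ (3 + ω (not t) + 6 * k)) * ((1 + q ^ (3 + 6 * k)) * ((1 + q ^ (ω t + 6 * k)) * W)))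
    ≡⟨ cong₂ _*_ (cong suc (split 6)) (cong₂ _*_ (cong suc (split (3 + ω (not t))))
       (cong₂ _*_ (cong suc (split 3)) (cong₂ _*_ (cong suc (split (ω t))) (parts-product q t k)))) ⟩
  (1 + q ^ 6 * y) * ((1 + q ^ (3 + ω (not t)) * y) * ((1 + Q * y) * ((1 + q ^ ω t * y) * P)))
    ≡⟨ regroup q (q ^ ω t) (q ^ ω (not t)) y P ⟩
  block Q (q ^ ω t) (q ^ ω (not t)) k * P ∎
  where
  open ≡-Reasoning
  Q = q ^ 3
  y = (Q * Q) ^ k
  W = product (map (λ p → 1 + q ^ p) (parts t k))
  P = Π[ k ] (block Q (q ^ ω t) (q ^ ω (not t)))
  split : ∀ r → q ^ (r + 6 * k) ≡ q ^ r * y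
  -- Since 6 = 3 + 3, the period 6 of the allowed parts is the factor Q² of a double shift.
  split r = trans (^-distribˡ-+-* q r (6 * k)) (cong (q ^ r *_)
    (trans (sym (^-*-assoc q 6 k)) (cong (_^ k) (^-distribˡ-+-* q 3 3))))
  regroup : ∀ q a b y P → let Q = q * (q * (q * 1)) in
    (1 + q * (q * (q * Q)) * y) * ((1 + q * (q * (q * b)) * y) * ((1 + Q * y) * ((1 + a * y) * P))) ≡
    (1 + a * y) * (1 + b * y * Q) * ((1 + Q * y) * (1 + Q * Q * y)) * P
  regroup = solve-∀

-- Comparing the coefficients of the two generating functions

A≡C : ∀ t n → (∀ N → n ≤ 3 * N → Enumerates (ACond (ω (not t))) n (alternating t N)) →
  A (ω (not t)) n ≡ C (ω (not t)) n
A≡C t n A-enumerates = begin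
  A (ω (not t)) n         ≡⟨ count-enumerated (A-enumerates (M + M) (n≤ (M + M) (m≤m+n M M))) ⟩
  occ n (map sum La)      ≡⟨ occ-unique q n (map sum La) (map sum Lc) (rest * u) (rest * v)
                               (s≤s (m≤m+n _ _)) (s≤s (m≤n+m _ (length (map sum La)))) congruence ⟩
  occ n (map sum Lc)      ≡⟨ count-enumerated (C-enumerates t M (≤-trans (n≤1+n n) (m≤n*m M 6))) ⟨
  C (ω (not t)) n         ∎
  where
  open ≡-Reasoning
  -- `q ^ M` is the first power beyond the coefficient of interest, and the bounds 6M on the parts
  -- of both families exceed n.
  M = suc n
  La = alternating t (M + M)
  Lc = distinct (parts t M)
  -- Neither list depends on q, so q may be chosen above both lengths and hence above all
  -- coefficients.
  q = suc (length (map sum La) + length (map sum Lc))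
  Q = q ^ 3
  n≤ : ∀ N → M ≤ N → n ≤ 3 * N
  n≤ N M≤N = ≤-trans (n≤1+n n) (≤-trans M≤N (m≤n*m N 3))
  -- The product formula holds modulo Q^(2M) = q^(6M), more than the q^M that is needed; this is the
  -- cofactor q^(5M).
  rest = (q * q * Q) ^ M
  limit = X-product Q (q ^ ω t) (q ^ ω (not t)) M
  u = proj₁ limit
  v = proj₁ (proj₂ limit)
  modulus : ∀ w → q ^ M * (rest * w) ≡ (Q * Q) ^ M * w
  modulus w = trans (sym (*-assoc (q ^ M) rest w)) (cong (_* w) (trans (sym (^-distribʳ-* q (q * q * Q) M))
    (cong (_^ M) (lemma q Q))))
    where
    lemma : ∀ q Q → q * (q * q * Q) ≡ q * (q * (q * 1)) * Q
    lemma = solve-∀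
  congruence : weight q La + q ^ M * (rest * u) ≡ weight q Lc + q ^ M * (rest * v)
  congruence = begin
    weight q La + q ^ M * (rest * u)
      ≡⟨ cong₂ _+_ (alternating-weight q t (M + M)) (modulus u) ⟩
    X Q (q ^ ω t) (q ^ ω (not t)) (M + M) + (Q * Q) ^ M * u
      ≡⟨ proj₂ (proj₂ limit) ⟩
    Π[ M ] (block Q (q ^ ω t) (q ^ ω (not t))) + (Q * Q) ^ M * v
      ≡⟨ cong₂ _+_ (trans (distinct-weight q (parts t M)) (parts-product q t M)) (modulus v) ⟨
    weight q Lc + q ^ M * (rest * v) ∎

theorem3 : (m : ℕ) → (m ≡ 1 ⊎ m ≡ 2) → (n : ℕ) → A m n ≡ C m n
theorem3 _ (inj₁ refl) n = A≡C true n A₁-enumerates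
theorem3 _ (inj₂ refl) n = A≡C false n A₂-enumerates
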